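{- The logic $\mathsf{CS4}$ has the finite model property: for every formula $\varphi$, if $\mathsf{CS4}\nvdash\varphi$, then there is a $\mathsf{CS4}$-model $\mathcal M=(W,W_\bot,\preccurlyeq,\sqsubseteq,V)$ with $W$ finite such that $\mathcal M\not\models\varphi$. (Conversely, every theorem of $\mathsf{CS4}$ is valid on all $\mathsf{CS4}$-models.)
   Context: Fix a countably infinite set $\mathbb P$ of propositional variables. Formulas: $\varphi,\psi ::= p\mid\bot\mid(\varphi\wedge\psi)\mid(\varphi\vee\psi)\mid(\varphi\to\psi)\mid\Diamond\varphi\mid\Box\varphi$ with $p\in\mathbb P$; $\neg\varphi:=\varphi\to\bot$. A bi-intuitionistic frame is $\mathcal F=(W,W_\bot,\preccurlyeq,\sqsubseteq)$ where $\preccurlyeq$ and $\sqsubseteq$ are preorders on a set $W$ and $W_\bot\subseteq W$ (the fallible worlds) is upward closed under both $\preccurlyeq$ and $\sqsubseteq$; it is infallible if $W_\bot=\varnothing$. A valuation is a map $V:\mathbb P\to 2^W$ such that each $V(p)$ is upward closed under $\preccurlyeq$ and $W_\bot\subseteq V(p)$; a model is $\mathcal M=(W,W_\bot,\preccurlyeq,\sqsubseteq,V)$. Satisfaction: $(\mathcal M,w)\models p$ iff $w\in V(p)$; $(\mathcal M,w)\models\bot$ iff $w\in W_\bot$; $\wedge,\vee$ pointwise; $(\mathcal M,w)\models\varphi\to\psi$ iff for all $v\succcurlyeq w$, $(\mathcal M,v)\models\varphi$ implies $(\mathcal M,v)\models\psi$; $(\mathcal M,w)\models\Diamond\varphi$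 iff for all $u\succcurlyeq w$ there is $v\sqsupseteq u$ with $(\mathcal M,v)\models\varphi$; $(\mathcal M,w)\models\Box\varphi$ iff for all $u,v$ with $w\preccurlyeq u\sqsubseteq v$, $(\mathcal M,v)\models\varphi$. $\mathcal M\models\varphi$ means $(\mathcal M,w)\models\varphi$ for all $w\in W\setminus W_\bot$. For $R\subseteq W\times W$ (relative to $\preccurlyeq$): $R$ is backward confluent if $wRv\preccurlyeq v'$ implies there is $w'$ with $w\preccurlyeq w'Rv'$. A $\mathsf{CS4}$-frame is a bi-intuitionistic frame in which $\sqsubseteq$ is backward confluent; a $\mathsf{CS4}$-model is a model on such a frame. $\mathsf{CS4}$ is the least set of formulas containing all intuitionistic propositional tautologies (in this language) and all instances of $\Box(\varphi\to\psi)\to(\Box\varphi\to\Box\psi)$, $\Box(\varphi\to\psi)\to(\Diamond\varphi\to\Diamond\psi)$, $\Box\varphi\to\varphi$, $\varphi\to\Diamond\varphi$, $\Box\varphi\to\Box\Box\varphi$, $\Diamond\Diamond\varphi\to\Diamond\varphi$, closed under modus ponens and necessitation (from $\varphi$ infer $\Box\varphi$). -}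

module Defs where

open import Data.Fin using (Fin)
open import Data.Nat using (ℕ)
open import Data.Product using (∃; _×_)
open import Data.Sum using (_⊎_)
open import Function.Bundles using (_↔_)
open import Level using (0ℓ)
open import Relation.Binary using (Rel; IsPreorder; _Respects_)
open import Relation.Binary.PropositionalEquality using (_≡_)
open import Relation.Nullary using (¬_)
open import Relation.Unary using (Pred; _⊆_)

infixr 7 _∧_
infixr 6 _∨_
infixr 5 _⇒_
infix  8 ◇_ □_

-- The countably infinite set of propositional variables is ℕ.
data Formula : Set where
  var         : ℕ → Formula
  ⊥′          : Formula
  _∧_ _∨_ _⇒_ : Formula → Formula → Formula
  ◇_ □_       : Formula → Formula

infix 2 IPC⊢_ CS4⊢_

-- Intuitionistic propositional tautologies in the modal language, in Hilbert
-- style: no axiom mentions ◇ or □, so modal formulas behave as atoms.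
data IPC⊢_ : Formula → Set where
  K    : ∀ {φ ψ} → IPC⊢ φ ⇒ (ψ ⇒ φ)
  S    : ∀ {φ ψ χ} → IPC⊢ (φ ⇒ (ψ ⇒ χ)) ⇒ ((φ ⇒ ψ) ⇒ (φ ⇒ χ))
  ∧-I  : ∀ {φ ψ} → IPC⊢ φ ⇒ (ψ ⇒ (φ ∧ ψ))
  ∧-E₁ : ∀ {φ ψ} → IPC⊢ (φ ∧ ψ) ⇒ φ
  ∧-E₂ : ∀ {φ ψ} → IPC⊢ (φ ∧ ψ) ⇒ ψ
  ∨-I₁ : ∀ {φ ψ} → IPC⊢ φ ⇒ (φ ∨ ψ)
  ∨-I₂ : ∀ {φ ψ} → IPC⊢ ψ ⇒ (φ ∨ ψ)
  ∨-E  : ∀ {φ ψ χ} → IPC⊢ (φ ⇒ χ) ⇒ ((ψ ⇒ χ) ⇒ ((φ ∨ ψ) ⇒ χ))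
  ⊥-E  : ∀ {φ} → IPC⊢ ⊥′ ⇒ φ
  MP   : ∀ {φ ψ} → IPC⊢ φ ⇒ ψ → IPC⊢ φ → IPC⊢ ψ

data CS4⊢_ : Formula → Set where
  taut : ∀ {φ} → IPC⊢ φ → CS4⊢ φ
  K□   : ∀ {φ ψ} → CS4⊢ □ (φ ⇒ ψ) ⇒ (□ φ ⇒ □ ψ)
  K◇   : ∀ {φ ψ} → CS4⊢ □ (φ ⇒ ψ) ⇒ (◇ φ ⇒ ◇ ψ)
  T□   : ∀ {φ} → CS4⊢ □ φ ⇒ φ
  T◇   : ∀ {φ} → CS4⊢ φ ⇒ ◇ φ
  4□   : ∀ {φ} → CS4⊢ □ φ ⇒ □ □ φ
  4◇   : ∀ {φ} → CS4⊢ ◇ ◇ φ ⇒ ◇ φ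
  MP   : ∀ {φ ψ} → CS4⊢ φ ⇒ ψ → CS4⊢ φ → CS4⊢ ψ
  Nec  : ∀ {φ} → CS4⊢ φ → CS4⊢ □ φ

-- P Respects R says that P is upward closed under R.
record Frame : Set₁ where
  infix 4 _≼_ _⊑_
  field
    W            : Set
    W⊥           : Pred W 0ℓ
    _≼_ _⊑_      : Rel W 0ℓ
    ≼-isPreorder : IsPreorder _≡_ _≼_
    ⊑-isPreorder : IsPreorder _≡_ _⊑_
    W⊥-≼-closed  : W⊥ Respects _≼_
    W⊥-⊑-closed  : W⊥ Respects _⊑_

record Model : Set₁ where
  field
    frame : Frame
  open Frame frame public
  field
    V          : ℕ → Pred W 0ℓ
    V-≼-closed : ∀ p → V p Respects _≼_
    W⊥⊆V       : ∀ p → W⊥ ⊆ V p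

infix 3 ⟨_,_⟩⊨_ _⊨_

⟨_,_⟩⊨_ : (M : Model) → Model.W M → Formula → Set
⟨ M , w ⟩⊨ var p   = Model.V M p w
⟨ M , w ⟩⊨ ⊥′      = Model.W⊥ M w
⟨ M , w ⟩⊨ (φ ∧ ψ) = (⟨ M , w ⟩⊨ φ) × (⟨ M , w ⟩⊨ ψ)
⟨ M , w ⟩⊨ (φ ∨ ψ) = (⟨ M , w ⟩⊨ φ) ⊎ (⟨ M , w ⟩⊨ ψ)
⟨ M , w ⟩⊨ (φ ⇒ ψ) = let open Model M in
  ∀ v → w ≼ v → ⟨ M , v ⟩⊨ φ → ⟨ M , v ⟩⊨ ψ
⟨ M , w ⟩⊨ ◇ φ     = let open Model M in
  ∀ u → w ≼ u → ∃ λ v → (u ⊑ v) × (⟨ M , v ⟩⊨ φ)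
⟨ M , w ⟩⊨ □ φ     = let open Model M in
  ∀ u v → w ≼ u → u ⊑ v → ⟨ M , v ⟩⊨ φ

_⊨_ : Model → Formula → Set
M ⊨ φ = ∀ w → ¬ Model.W⊥ M w → ⟨ M , w ⟩⊨ φ

BackwardConfluent : {W : Set} → Rel W 0ℓ → Rel W 0ℓ → Set
BackwardConfluent _≼_ R =
  ∀ {w v v′} → R w v → v ≼ v′ → ∃ λ w′ → (w ≼ w′) × R w′ v′

IsCS4Frame : Frame → Set
IsCS4Frame F = BackwardConfluent _≼_ _⊑_
  where open Frame F

record CS4Model : Set₁ where
  field
    model      : Model
    isCS4Frame : IsCS4Frame (Model.frame model)
  open Model model public

Finite : Set → Set
Finite A = ∃ λ n → A ↔ Fin n

{-# OPTIONS --safe #-}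

-- Completeness is witnessed by a finite canonical model over a finite set Φ of
-- formulas closed under subformulas.  A world is a prime Φ-theory Γ together with
-- at most one promise: a formula ψ with Γ ⊬ ◇ψ, which has to stay false along ⊑.
-- The order ≼ is inclusion of theories and ignores promises; ⊑ preserves the boxed
-- formulas of Γ and the promise.  Dropping the promise of a world therefore gives
-- backward confluence, and making the promise ψ refutes ◇ψ.
--
-- Derivability, hence being a prime theory, is not decidable a priori, so the
-- carrier consists of all pairs (subset of Φ, promise), and pairs that are not
-- worlds are isolated points.  Since ¬ (M ⊨ φ) is a negation, the finitely many
-- instances of excluded middle needed to extend theories to prime ones are
-- available when proving it.
module Submission where

open import Data.Bool using (Bool)
open import Data.Bool.Properties using (T-≡)
open import Data.Fin using (Fin)
open import Data.Fin.Properties using (1↔⊤; 2↔Bool; +↔⊎; *↔×; any?; sequence)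
open import Data.Fin.Subset using (Subset; ⁅_⁆; _⊃_)
  renaming (_∈_ to _∈ₛ_; _⊆_ to _⊆ₛ_; _∪_ to _∪ₛ_; ⊥ to ∅ₛ; ⊤ to fullₛ)
open import Data.Fin.Subset.Induction using (⊃-wellFounded; Acc; acc)
open import Data.Fin.Subset.Properties
  using (_∈?_; ∉⊥; ∈⊤; ⊆⊤; x∈⁅x⁆; x∈⁅y⁆⇒x≡y; p⊆p∪q; q⊆p∪q; x∈p∪q⁻)
open import Data.List using (List; []; _∷_; _++_; length; lookup)
open import Data.List.Membership.Propositional using (_∈_)
open import Data.List.Membership.Propositional.Properties using (∈-++⁺ˡ; ∈-++⁺ʳ; ∈-++⁻; ∈-lookup)
open import Data.List.Relation.Unary.Any using (here; there; index)
open import Data.List.Relation.Unary.Any.Properties using (lookup-index)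
open import Data.Maybe using (Maybe; just; nothing)
import Data.Maybe.Relation.Unary.All as Maybe
open import Data.Nat using (ℕ)
open import Data.Product using (∃-syntax; Σ-syntax; _×_; _,_; proj₁; proj₂)
open import Data.Product.Function.NonDependent.Propositional using (_×-↔_)
open import Data.Sum as Sum using (_⊎_; inj₁; inj₂; [_,_]′)
open import Data.Sum.Function.Propositional using (_⊎-↔_)
open import Data.Unit using (⊤; tt)
open import Data.Vec using (tabulate)
open import Data.Vec.Properties using (lookup∘tabulate; lookup⇒[]=; []=⇒lookup)
open import Data.Vec.Recursive using (lift↔; Fin[m^n]↔Fin[m]^n)
open import Data.Vec.Recursive.Properties using (↔Vec)
open import Effect.Monad using (RawMonad)
open import Function using (_∘_; id; _↔_; mk↔ₛ′; module Equivalence; module Inverse)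
open import Function.Properties.Inverse using (↔-refl; ↔-sym; ↔-trans)
open import Level using (Level; 0ℓ; _⊔_)
open import Relation.Binary using (Rel; Reflexive; Transitive; IsPreorder; _Respects_)
open import Relation.Binary.Construct.Closure.Reflexive using (ReflClosure; refl; [_])
import Relation.Binary.Construct.Closure.Reflexive.Properties as ReflClosure
open import Relation.Binary.PropositionalEquality using (_≡_; refl; sym; trans; subst)
open import Relation.Nullary using (¬_; Dec; yes; no; contradiction)
open import Relation.Nullary.Decidable
  using (⌊_⌋; toWitness; fromWitness; ¬?; _×-dec_; ¬¬-excluded-middle)
open import Relation.Nullary.Negation using (¬¬-Monad; ¬¬-map)
open import Relation.Unary using (Pred; Decidable; ∅; ｛_｝; _⊆_; _∩_; _∪_; _≐_)
open import Defs

private variable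
  a ℓ ℓ′ : Level
  A B    : Set
  n      : ℕ
  φ ψ θ  : Formula

-- Soundness

module _ (M : Model) where
  open Model M

  private
    module ≼ = IsPreorder ≼-isPreorder
    module ⊑ = IsPreorder ⊑-isPreorder

  ⊨-mono : ∀ φ → (⟨ M ,_⟩⊨ φ) Respects _≼_
  ⊨-mono (var p) w≼v w∈Vp        = V-≼-closed p w≼v w∈Vp
  ⊨-mono ⊥′      w≼v w∈W⊥        = W⊥-≼-closed w≼v w∈W⊥
  ⊨-mono (φ ∧ ψ) w≼v (⊨φ , ⊨ψ)   = ⊨-mono φ w≼v ⊨φ , ⊨-mono ψ w≼v ⊨ψ
  ⊨-mono (φ ∨ ψ) w≼v             = Sum.map (⊨-mono φ w≼v) (⊨-mono ψ w≼v)
  ⊨-mono (φ ⇒ ψ) w≼v ⊨φ⇒ψ u v≼u  = ⊨φ⇒ψ u (≼.trans w≼v v≼u)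
  ⊨-mono (◇ φ)   w≼v ⊨◇φ u v≼u   = ⊨◇φ u (≼.trans w≼v v≼u)
  ⊨-mono (□ φ)   w≼v ⊨□φ u t v≼u = ⊨□φ u t (≼.trans w≼v v≼u)

  W⊥⊆⊨ : ∀ φ → W⊥ ⊆ (⟨ M ,_⟩⊨ φ)
  W⊥⊆⊨ (var p) w∈W⊥             = W⊥⊆V p w∈W⊥
  W⊥⊆⊨ ⊥′      w∈W⊥             = w∈W⊥
  W⊥⊆⊨ (φ ∧ ψ) w∈W⊥             = W⊥⊆⊨ φ w∈W⊥ , W⊥⊆⊨ ψ w∈W⊥
  W⊥⊆⊨ (φ ∨ ψ) w∈W⊥             = inj₁ (W⊥⊆⊨ φ w∈W⊥)
  W⊥⊆⊨ (φ ⇒ ψ) w∈W⊥ v w≼v _     = W⊥⊆⊨ ψ (W⊥-≼-closed w≼v w∈W⊥)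
  W⊥⊆⊨ (◇ φ)   w∈W⊥ u w≼u       = u , ⊑.refl , W⊥⊆⊨ φ (W⊥-≼-closed w≼u w∈W⊥)
  W⊥⊆⊨ (□ φ)   w∈W⊥ u v w≼u u⊑v = W⊥⊆⊨ φ (W⊥-⊑-closed u⊑v (W⊥-≼-closed w≼u w∈W⊥))

  IPC-sound : IPC⊢ φ → ∀ w → ⟨ M , w ⟩⊨ φ
  IPC-sound (K {φ}) w _ _ ⊨φ u v≼u _ = ⊨-mono φ v≼u ⊨φ
  IPC-sound S w _ _ ⊨φ⇒ψ⇒χ _ v≼u ⊨φ⇒ψ t u≼t ⊨φ =
    ⊨φ⇒ψ⇒χ t (≼.trans v≼u u≼t) ⊨φ t ≼.refl (⊨φ⇒ψ t u≼t ⊨φ)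
  IPC-sound (∧-I {φ}) w _ _ ⊨φ _ v≼u ⊨ψ = ⊨-mono φ v≼u ⊨φ , ⊨ψ
  IPC-sound ∧-E₁ w _ _ = proj₁
  IPC-sound ∧-E₂ w _ _ = proj₂
  IPC-sound ∨-I₁ w _ _ = inj₁
  IPC-sound ∨-I₂ w _ _ = inj₂
  IPC-sound ∨-E w _ _ ⊨φ⇒χ _ v≼u ⊨ψ⇒χ t u≼t =
    [ ⊨φ⇒χ t (≼.trans v≼u u≼t) , ⊨ψ⇒χ t u≼t ]′
  IPC-sound (⊥-E {φ}) w _ _ = W⊥⊆⊨ φ
  IPC-sound (MP ⊢φ⇒ψ ⊢φ) w = IPC-sound ⊢φ⇒ψ w w ≼.refl (IPC-sound ⊢φ w)

  module _ (confluent : IsCS4Frame frame) where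

    CS4-sound : CS4⊢ φ → ∀ w → ⟨ M , w ⟩⊨ φ
    CS4-sound (taut ⊢φ) = IPC-sound ⊢φ
    CS4-sound K□ w _ _ ⊨□φ⇒ψ _ v≼u ⊨□φ s t u≼s s⊑t =
      ⊨□φ⇒ψ s t (≼.trans v≼u u≼s) s⊑t t ≼.refl (⊨□φ s t u≼s s⊑t)
    CS4-sound K◇ w _ _ ⊨□φ⇒ψ _ v≼u ⊨◇φ s u≼s =
      let t , s⊑t , ⊨φ = ⊨◇φ s u≼s
      in  t , s⊑t , ⊨□φ⇒ψ s t (≼.trans v≼u u≼s) s⊑t t ≼.refl ⊨φ
    CS4-sound T□ w v _ ⊨□φ = ⊨□φ v v ≼.refl ⊑.refl
    CS4-sound (T◇ {φ}) w _ _ ⊨φ u v≼u = u , ⊑.refl , ⊨-mono φ v≼u ⊨φ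
    CS4-sound 4□ w _ _ ⊨□φ _ _ v≼s s⊑t _ u t≼r r⊑u =
      let s′ , s≼s′ , s′⊑r = confluent s⊑t t≼r
      in  ⊨□φ s′ u (≼.trans v≼s s≼s′) (⊑.trans s′⊑r r⊑u)
    CS4-sound 4◇ w _ _ ⊨◇◇φ u v≼u =
      let s , u⊑s , ⊨◇φ = ⊨◇◇φ u v≼u
          t , s⊑t , ⊨φ  = ⊨◇φ s ≼.refl
      in  t , ⊑.trans u⊑s s⊑t , ⊨φ
    CS4-sound (MP ⊢φ⇒ψ ⊢φ) w = CS4-sound ⊢φ⇒ψ w w ≼.refl (CS4-sound ⊢φ w)
    CS4-sound (Nec ⊢φ) w _ v _ _ = CS4-sound ⊢φ v

-- Subformulas

infix 4 _◁_

data _◁_ : Rel Formula 0ℓ where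
  ∧ˡ : φ ◁ φ ∧ ψ
  ∧ʳ : ψ ◁ φ ∧ ψ
  ∨ˡ : φ ◁ φ ∨ ψ
  ∨ʳ : ψ ◁ φ ∨ ψ
  ⇒ˡ : φ ◁ φ ⇒ ψ
  ⇒ʳ : ψ ◁ φ ⇒ ψ
  ◇⁻ : φ ◁ ◇ φ
  □⁻ : φ ◁ □ φ

SubformulaClosed : Pred Formula 0ℓ → Set
SubformulaClosed Φ = ∀ {φ ψ} → φ ◁ ψ → Φ ψ → Φ φ

subformulas properSubformulas : Formula → List Formula
subformulas φ = φ ∷ properSubformulas φ
properSubformulas (var _) = []
properSubformulas ⊥′      = []
properSubformulas (φ ∧ ψ) = subformulas φ ++ subformulas ψ
properSubformulas (φ ∨ ψ) = subformulas φ ++ subformulas ψ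
properSubformulas (φ ⇒ ψ) = subformulas φ ++ subformulas ψ
properSubformulas (◇ φ)   = subformulas φ
properSubformulas (□ φ)   = subformulas φ

◁⇒∈-properSubformulas : φ ◁ ψ → φ ∈ properSubformulas ψ
◁⇒∈-properSubformulas ∧ˡ           = here refl
◁⇒∈-properSubformulas (∧ʳ {φ = φ}) = ∈-++⁺ʳ (subformulas φ) (here refl)
◁⇒∈-properSubformulas ∨ˡ           = here refl
◁⇒∈-properSubformulas (∨ʳ {φ = φ}) = ∈-++⁺ʳ (subformulas φ) (here refl)
◁⇒∈-properSubformulas ⇒ˡ           = here refl
◁⇒∈-properSubformulas (⇒ʳ {φ = φ}) = ∈-++⁺ʳ (subformulas φ) (here refl)
◁⇒∈-properSubformulas ◇⁻           = here refl
◁⇒∈-properSubformulas □⁻           = here refl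

++-subformulaClosed : ∀ {φs ψs} → SubformulaClosed (_∈ φs) → SubformulaClosed (_∈ ψs) →
                      SubformulaClosed (_∈ φs ++ ψs)
++-subformulaClosed {φs} φs-closed ψs-closed φ◁ψ ψ∈ with ∈-++⁻ φs ψ∈
... | inj₁ ψ∈φs = ∈-++⁺ˡ (φs-closed φ◁ψ ψ∈φs)
... | inj₂ ψ∈ψs = ∈-++⁺ʳ φs (ψs-closed φ◁ψ ψ∈ψs)

subformulas-closed       : ∀ φ → SubformulaClosed (_∈ subformulas φ)
properSubformulas-closed : ∀ φ → SubformulaClosed (_∈ properSubformulas φ)

subformulas-closed φ ψ◁φ (here refl) = there (◁⇒∈-properSubformulas ψ◁φ)
subformulas-closed φ ψ◁χ (there χ∈)  = there (properSubformulas-closed φ ψ◁χ χ∈)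

properSubformulas-closed (φ ∧ ψ) =
  ++-subformulaClosed (subformulas-closed φ) (subformulas-closed ψ)
properSubformulas-closed (φ ∨ ψ) =
  ++-subformulaClosed (subformulas-closed φ) (subformulas-closed ψ)
properSubformulas-closed (φ ⇒ ψ) =
  ++-subformulaClosed (subformulas-closed φ) (subformulas-closed ψ)
properSubformulas-closed (◇ φ)   = subformulas-closed φ
properSubformulas-closed (□ φ)   = subformulas-closed φ

-- Derivability from a context

Context : Set₁
Context = Pred Formula 0ℓ

private variable
  Γ Δ Θ Φ : Context

infix 2 _⊢_

data _⊢_ (Γ : Context) : Formula → Set where
  hyp : Γ φ → Γ ⊢ φ
  thm : CS4⊢ φ → Γ ⊢ φ
  mp  : Γ ⊢ φ ⇒ ψ → Γ ⊢ φ → Γ ⊢ ψ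

ax : IPC⊢ φ → Γ ⊢ φ
ax = thm ∘ taut

⊥-elim : Γ ⊢ ⊥′ → Γ ⊢ φ
⊥-elim = mp (ax ⊥-E)

weaken : Γ ⊆ Δ → Γ ⊢ φ → Δ ⊢ φ
weaken Γ⊆Δ (hyp φ∈Γ)    = hyp (Γ⊆Δ φ∈Γ)
weaken Γ⊆Δ (thm ⊢φ)     = thm ⊢φ
weaken Γ⊆Δ (mp ⊢φ⇒ψ ⊢φ) = mp (weaken Γ⊆Δ ⊢φ⇒ψ) (weaken Γ⊆Δ ⊢φ)

deduction : Γ ∪ ｛ φ ｝ ⊢ ψ → Γ ⊢ φ ⇒ ψ
deduction (hyp (inj₁ ψ∈Γ))          = mp (ax K) (hyp ψ∈Γ)
deduction {φ = φ} (hyp (inj₂ refl)) = mp (mp (ax S) (ax K)) (ax (K {ψ = φ}))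
deduction (thm ⊢ψ)                  = mp (ax K) (thm ⊢ψ)
deduction (mp ⊢χ⇒ψ ⊢χ)              = mp (mp (ax S) (deduction ⊢χ⇒ψ)) (deduction ⊢χ)

∅⊢⇒CS4⊢ : ∅ ⊢ φ → CS4⊢ φ
∅⊢⇒CS4⊢ (thm ⊢φ)     = ⊢φ
∅⊢⇒CS4⊢ (mp ⊢φ⇒ψ ⊢φ) = MP (∅⊢⇒CS4⊢ ⊢φ⇒ψ) (∅⊢⇒CS4⊢ ⊢φ)

data Boxed : Pred Formula 0ℓ where
  boxed : Boxed (□ φ)

boxed? : Decidable Boxed
boxed? (var _) = no λ ()
boxed? ⊥′      = no λ ()
boxed? (_ ∧ _) = no λ ()
boxed? (_ ∨ _) = no λ ()
boxed? (_ ⇒ _) = no λ ()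
boxed? (◇ _)   = no λ ()
boxed? (□ _)   = yes boxed

necessitation : Γ ⊆ Boxed → Γ ⊢ φ → Γ ⊢ □ φ
necessitation Γ⊆Boxed (hyp φ∈Γ) with boxed ← Γ⊆Boxed φ∈Γ = mp (thm 4□) (hyp φ∈Γ)
necessitation Γ⊆Boxed (thm ⊢φ) = thm (Nec ⊢φ)
necessitation Γ⊆Boxed (mp ⊢φ⇒ψ ⊢φ) =
  mp (mp (thm K□) (necessitation Γ⊆Boxed ⊢φ⇒ψ)) (necessitation Γ⊆Boxed ⊢φ)

□-intro : Γ ∩ Boxed ⊢ φ → Γ ⊢ □ φ
□-intro = weaken proj₁ ∘ necessitation proj₂

◇-elim : (Γ ∩ Boxed) ∪ ｛ φ ｝ ⊢ ◇ ψ → Γ ⊢ ◇ φ → Γ ⊢ ◇ ψ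
◇-elim ⊢◇ψ ⊢◇φ = mp (thm 4◇) (mp (mp (thm K◇) (□-intro (deduction ⊢◇ψ))) ⊢◇φ)

record IsPrime (Φ Γ : Context) : Set where
  field
    closed : Φ φ → Γ ⊢ φ → Γ φ
    prime  : Φ φ → Φ ψ → Γ ⊢ φ ∨ ψ → Γ φ ⊎ Γ ψ

maximal⇒prime : ¬ (Γ ⊢ θ) → (∀ {φ} → Φ φ → Γ φ ⊎ (Γ ∪ ｛ φ ｝ ⊢ θ)) → IsPrime Φ Γ
maximal⇒prime {Γ} {θ} {Φ} Γ⊬θ maximal = record { closed = closed ; prime = prime }
  where
  closed : Φ φ → Γ ⊢ φ → Γ φ
  closed φ∈Φ ⊢φ with maximal φ∈Φ
  ... | inj₁ φ∈Γ = φ∈Γ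
  ... | inj₂ φ⊢θ = contradiction (mp (deduction φ⊢θ) ⊢φ) Γ⊬θ

  prime : Φ φ → Φ ψ → Γ ⊢ φ ∨ ψ → Γ φ ⊎ Γ ψ
  prime φ∈Φ ψ∈Φ ⊢φ∨ψ with maximal φ∈Φ | maximal ψ∈Φ
  ... | inj₁ φ∈Γ | _        = inj₁ φ∈Γ
  ... | inj₂ _   | inj₁ ψ∈Γ = inj₂ ψ∈Γ
  ... | inj₂ φ⊢θ | inj₂ ψ⊢θ =
    contradiction (mp (mp (mp (ax ∨-E) (deduction φ⊢θ)) (deduction ψ⊢θ)) ⊢φ∨ψ) Γ⊬θ

infix 4 _⊆□_

_⊆□_ : Rel Context 0ℓ
Γ ⊆□ Δ = Γ ∩ Boxed ⊆ Δ

⊆□-trans : Γ ⊆□ Δ → Δ ⊆□ Θ → Γ ⊆□ Θ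
⊆□-trans Γ⊆□Δ Δ⊆□Θ (φ∈Γ , φ-boxed) = Δ⊆□Θ (Γ⊆□Δ (φ∈Γ , φ-boxed) , φ-boxed)

□-elim-⊆□ : IsPrime Φ Γ → Γ ⊆□ Δ → Φ (□ φ) → Γ ⊢ □ φ → Δ ⊢ φ
□-elim-⊆□ Γ-prime Γ⊆□Δ □φ∈Φ ⊢□φ =
  mp (thm T□) (hyp (Γ⊆□Δ (IsPrime.closed Γ-prime □φ∈Φ ⊢□φ , boxed)))

-- Finite types and subsets

Fin-finite : ∀ n → Finite (Fin n)
Fin-finite n = n , ↔-refl

×-finite : Finite A → Finite B → Finite (A × B)
×-finite (_ , A↔Fin) (_ , B↔Fin) = _ , ↔-trans (A↔Fin ×-↔ B↔Fin) (↔-sym *↔×)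

Maybe-finite : Finite A → Finite (Maybe A)
Maybe-finite {A} (_ , A↔Fin) =
  _ , ↔-trans Maybe↔⊤⊎ (↔-trans (↔-sym 1↔⊤ ⊎-↔ A↔Fin) (↔-sym +↔⊎))
  where
  Maybe↔⊤⊎ : Maybe A ↔ (⊤ ⊎ A)
  Maybe↔⊤⊎ = mk↔ₛ′
    (λ { nothing → inj₁ tt ; (just x) → inj₂ x }) [ (λ _ → nothing) , just ]′
    (λ { (inj₁ _) → refl ; (inj₂ _) → refl }) (λ { nothing → refl ; (just _) → refl })

Subset-finite : ∀ n → Finite (Subset n)
Subset-finite n = _ , ↔-trans (↔-sym (↔Vec n))
                              (↔-trans (lift↔ n (↔-sym 2↔Bool)) (↔-sym (Fin[m^n]↔Fin[m]^n 2 n)))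

¬¬-finite-∀ : ∀ {P : Pred A ℓ} → Finite A → (∀ x → ¬ ¬ P x) → ¬ ¬ (∀ x → P x)
¬¬-finite-∀ {P = P} (_ , A↔Fin) ∀¬¬P =
  ¬¬-map (λ ∀P x → subst P (strictlyInverseʳ x) (∀P (to x)))
         (sequence (RawMonad.rawApplicative ¬¬-Monad) (∀¬¬P ∘ from))
  where open Inverse A↔Fin

comprehension : ∀ {P : Pred (Fin n) ℓ} → Decidable P → ∃[ p ] P ≐ (_∈ₛ p)
comprehension {n = n} {P = P} P? = tabulate char , P⊆∈ , ∈⊆P
  where
  open Equivalence

  char : Fin n → Bool
  char i = ⌊ P? i ⌋

  P⊆∈ : P ⊆ (_∈ₛ tabulate char)
  P⊆∈ {i} Pi = lookup⇒[]= i _ (trans (lookup∘tabulate char i) (to T-≡ (fromWitness Pi)))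

  ∈⊆P : (_∈ₛ tabulate char) ⊆ P
  ∈⊆P {i} i∈ = toWitness (from T-≡ (trans (sym (lookup∘tabulate char i)) ([]=⇒lookup i∈)))

maximal-above : ∀ {P : Pred (Subset n) ℓ} → Decidable P → ∀ p → P p →
                ∃[ q ] p ⊆ₛ q × P q × (∀ i → P (q ∪ₛ ⁅ i ⁆) → i ∈ₛ q)
maximal-above {n = n} {P = P} P? p = extend p (⊃-wellFounded p)
  where
  extend : ∀ p → Acc _⊃_ p → P p → ∃[ q ] p ⊆ₛ q × P q × (∀ i → P (q ∪ₛ ⁅ i ⁆) → i ∈ₛ q)
  extend p (acc rec) Pp with any? (λ i → P? (p ∪ₛ ⁅ i ⁆) ×-dec ¬? (i ∈? p))
  ... | yes (i , Pp∪i , i∉p) =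
    let p∪i⊃p : (p ∪ₛ ⁅ i ⁆) ⊃ p
        p∪i⊃p = p⊆p∪q _ , i , q⊆p∪q p _ (x∈⁅x⁆ i) , i∉p
        q , p∪i⊆q , Pq , maximal = extend (p ∪ₛ ⁅ i ⁆) (rec p∪i⊃p) Pp∪i
    in  q , p∪i⊆q ∘ p⊆p∪q _ , Pq , maximal
  ... | no ∄i = p , id , Pp , maximal
    where
    maximal : ∀ i → P (p ∪ₛ ⁅ i ⁆) → i ∈ₛ p
    maximal i Pp∪i with i ∈? p
    ... | yes i∈p = i∈p
    ... | no  i∉p = contradiction (i , Pp∪i , i∉p) ∄i

-- Restriction of relations

infix 8 _↾_

_↾_ : {A : Set a} → Rel A ℓ → Pred A ℓ′ → Rel A (a ⊔ ℓ ⊔ ℓ′)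
R ↾ P = ReflClosure λ x y → P x × P y × R x y

module _ {A : Set a} {R : Rel A ℓ} {P : Pred A ℓ′} where

  ↾-isPreorder : Transitive R → IsPreorder _≡_ (R ↾ P)
  ↾-isPreorder R-trans =
    ReflClosure.isPreorder λ (Px , _ , xRy) (_ , Pz , yRz) → Px , Pz , R-trans xRy yRz

  ↾-elim : Reflexive R → ∀ {x y} → P x → (R ↾ P) x y → P y × R x y
  ↾-elim R-refl Px refl             = Px , R-refl
  ↾-elim R-refl _  [ _ , Py , xRy ] = Py , xRy

  ↾-respects : ∀ {q} {Q : Pred A q} → (∀ {x y} → P x → R x y → Q x → Q y) →
               (P ∩ Q) Respects (R ↾ P)
  ↾-respects Q-resp = ReflClosure.resp λ (_ , Py , xRy) (Px , Qx) → Py , Q-resp Px xRy Qx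

↾-backwardConfluent : {P : Pred A 0ℓ} {R S : Rel A 0ℓ} →
  (∀ {x y z} → P x → R x y → S y z → ∃[ x′ ] P x′ × S x x′ × R x′ z) →
  BackwardConfluent (S ↾ P) (R ↾ P)
↾-backwardConfluent _         xRy  refl = _ , refl , xRy
↾-backwardConfluent _         refl ySz  = _ , ySz , refl
↾-backwardConfluent confluent [ Px , _ , xRy ] [ _ , Pz , ySz ] =
  let x′ , Px′ , xSx′ , x′Rz = confluent Px xRy ySz
  in  x′ , [ Px , Px′ , xSx′ ] , [ Px′ , Pz , x′Rz ]

-- Theories in a finite set of formulas

module Theories (Φ : List Formula) where

  Theory : Set
  Theory = Subset (length Φ)

  private variable
    X : Context

  ⟦_⟧ : Theory → Context
  ⟦ Γ ⟧ φ = ∃[ i ] i ∈ₛ Γ × lookup Φ i ≡ φ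

  ∈⇒lookup : φ ∈ Φ → ∃[ i ] lookup Φ i ≡ φ
  ∈⇒lookup φ∈Φ = index φ∈Φ , sym (lookup-index φ∈Φ)

  ⟦full⟧ : φ ∈ Φ → ⟦ fullₛ ⟧ φ
  ⟦full⟧ φ∈Φ = let i , eq = ∈⇒lookup φ∈Φ in i , ∈⊤ , eq

  ⟦⟧-mono : ∀ {Γ Δ} → Γ ⊆ₛ Δ → ⟦ Γ ⟧ ⊆ ⟦ Δ ⟧
  ⟦⟧-mono Γ⊆Δ (i , i∈Γ , eq) = i , Γ⊆Δ i∈Γ , eq

  ⟦∪⁅⁆⟧ : ∀ Γ i → ⟦ Γ ⟧ ∪ ｛ lookup Φ i ｝ ≐ ⟦ Γ ∪ₛ ⁅ i ⁆ ⟧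
  ⟦∪⁅⁆⟧ Γ i = [ ⟦⟧-mono (p⊆p∪q _) , (λ eq → i , q⊆p∪q Γ _ (x∈⁅x⁆ i) , eq) ]′ , split
    where
    split : ⟦ Γ ∪ₛ ⁅ i ⁆ ⟧ ⊆ ⟦ Γ ⟧ ∪ ｛ lookup Φ i ｝
    split (j , j∈ , eq) with x∈p∪q⁻ Γ ⁅ i ⁆ j∈
    ... | inj₁ j∈Γ = inj₁ (j , j∈Γ , eq)
    ... | inj₂ j∈i with refl ← x∈⁅y⁆⇒x≡y i j∈i = inj₂ eq

  Representable : Context → Set
  Representable X = ∃[ Γ ] X ≐ ⟦ Γ ⟧

  ⟦⟧-representable : ∀ Γ → Representable ⟦ Γ ⟧
  ⟦⟧-representable Γ = Γ , id , id

  ∅-representable : Representable ∅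
  ∅-representable = ∅ₛ , (λ ()) , λ (_ , i∈∅ , _) → contradiction i∈∅ ∉⊥

  ∪-representable : φ ∈ Φ → Representable X → Representable (X ∪ ｛ φ ｝)
  ∪-representable φ∈Φ (Γ , X⊆Γ , Γ⊆X) with i , refl ← ∈⇒lookup φ∈Φ =
    let ⊆∪ , ∪⊆ = ⟦∪⁅⁆⟧ Γ i
    in  Γ ∪ₛ ⁅ i ⁆ , ⊆∪ ∘ Sum.map₁ X⊆Γ , Sum.map₁ Γ⊆X ∘ ∪⊆

  ∩-representable : ∀ {P} → Decidable P → Representable X → Representable (X ∩ P)
  ∩-representable {X = X} {P} P? (Γ , X⊆Γ , Γ⊆X)
    with Δ , Γ∩P⊆Δ , Δ⊆Γ∩P ← comprehension (λ i → (i ∈? Γ) ×-dec P? (lookup Φ i)) =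
    Δ , X∩P⊆Δ , Δ⊆X∩P
    where
    X∩P⊆Δ : X ∩ P ⊆ ⟦ Δ ⟧
    X∩P⊆Δ (φ∈X , Pφ) with i , i∈Γ , refl ← X⊆Γ φ∈X = i , Γ∩P⊆Δ (i∈Γ , Pφ) , refl

    Δ⊆X∩P : ⟦ Δ ⟧ ⊆ X ∩ P
    Δ⊆X∩P (i , i∈Δ , refl) = let i∈Γ , Pφ = Δ⊆Γ∩P i∈Δ in Γ⊆X (i , i∈Γ , refl) , Pφ

  Decides : Formula → Set
  Decides θ = ∀ Γ → Dec (⟦ Γ ⟧ ⊢ θ)

  ¬¬-decides : (f : Formula → Formula) → ¬ ¬ (∀ {φ} → φ ∈ Φ → Decides (f φ))
  ¬¬-decides f = ¬¬-map decides
    (¬¬-finite-∀ (×-finite (Subset-finite _) (Fin-finite _)) λ _ → ¬¬-excluded-middle)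
    where
    decides : (∀ ((Γ , i) : Theory × Fin (length Φ)) → Dec (⟦ Γ ⟧ ⊢ f (lookup Φ i))) →
              ∀ {φ} → φ ∈ Φ → Decides (f φ)
    decides ⊢? φ∈Φ Γ with i , refl ← ∈⇒lookup φ∈Φ = ⊢? (Γ , i)

  Separable : Context → Formula → Set
  Separable X θ = ∃[ Γ ] X ⊆ ⟦ Γ ⟧ × IsPrime (_∈ Φ) ⟦ Γ ⟧ × ¬ (⟦ Γ ⟧ ⊢ θ)

  lindenbaum : Decides θ → Representable X → X ⊢ θ ⊎ Separable X θ
  lindenbaum {θ} ⊢θ? (Γ , X⊆Γ , Γ⊆X) with ⊢θ? Γ
  ... | yes Γ⊢θ = inj₁ (weaken Γ⊆X Γ⊢θ)
  ... | no  Γ⊬θ =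
    let Δ , Γ⊆Δ , Δ⊬θ , maximal = maximal-above (¬? ∘ ⊢θ?) Γ Γ⊬θ
    in  inj₂ (Δ , ⟦⟧-mono Γ⊆Δ ∘ X⊆Γ , maximal⇒prime Δ⊬θ (member-or-refuted Δ maximal) , Δ⊬θ)
    where
    member-or-refuted : ∀ Δ → (∀ i → ¬ (⟦ Δ ∪ₛ ⁅ i ⁆ ⟧ ⊢ θ) → i ∈ₛ Δ) →
                        ∀ {φ} → φ ∈ Φ → ⟦ Δ ⟧ φ ⊎ (⟦ Δ ⟧ ∪ ｛ φ ｝ ⊢ θ)
    member-or-refuted Δ maximal φ∈Φ with i , refl ← ∈⇒lookup φ∈Φ with ⊢θ? (Δ ∪ₛ ⁅ i ⁆)
    ... | yes ⊢θ = inj₂ (weaken (proj₂ (⟦∪⁅⁆⟧ Δ i)) ⊢θ)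
    ... | no  ⊬θ = inj₁ (i , maximal i ⊬θ , refl)

-- The canonical model

module Canonical (Φ : List Formula) (Φ-closed : SubformulaClosed (_∈ Φ)) (□⊥∈Φ : □ ⊥′ ∈ Φ) where
  open Theories Φ

  Promise World : Set
  Promise = Maybe (Fin (length Φ))
  World   = Theory × Promise

  private variable
    x y : World

  Keeps : Context → Pred Promise 0ℓ
  Keeps Γ = Maybe.All λ i → ¬ (Γ ⊢ ◇ lookup Φ i)

  IsWorld : Pred World 0ℓ
  IsWorld (Γ , d) = IsPrime (_∈ Φ) ⟦ Γ ⟧ × Keeps ⟦ Γ ⟧ d

  Proves : Formula → Pred World 0ℓ
  Proves φ (Γ , _) = ⟦ Γ ⟧ ⊢ φ

  infix 4 _≤ₚ_ _≼₀_ _⊑₀_ _≼_ _⊑_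

  data _≤ₚ_ : Rel Promise 0ℓ where
    drop : ∀ {d} → nothing ≤ₚ d
    keep : ∀ {d} → d ≤ₚ d

  ≤ₚ-trans : Transitive _≤ₚ_
  ≤ₚ-trans drop _   = drop
  ≤ₚ-trans keep d≤e = d≤e

  _≼₀_ _⊑₀_ _≼_ _⊑_ : Rel World 0ℓ
  (Γ , _) ≼₀ (Δ , _) = ⟦ Γ ⟧ ⊆ ⟦ Δ ⟧
  (Γ , d) ⊑₀ (Δ , e) = ⟦ Γ ⟧ ⊆□ ⟦ Δ ⟧ × d ≤ₚ e
  _≼_ = _≼₀_ ↾ IsWorld
  _⊑_ = _⊑₀_ ↾ IsWorld

  ⊑₀-trans : Transitive _⊑₀_
  ⊑₀-trans (Γ⊆□Δ , d≤e) (Δ⊆□Θ , e≤f) = ⊆□-trans Γ⊆□Δ Δ⊆□Θ , ≤ₚ-trans d≤e e≤f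

  Proves-≼-closed : ∀ φ → (IsWorld ∩ Proves φ) Respects _≼_
  Proves-≼-closed _ = ↾-respects {R = _≼₀_} λ _ Γ⊆Δ → weaken Γ⊆Δ

  -- The boxed formula □⊥ ∈ Φ carries fallibility along ⊑.
  Proves⊥-⊑-closed : (IsWorld ∩ Proves ⊥′) Respects _⊑_
  Proves⊥-⊑-closed = ↾-respects {R = _⊑₀_} λ (Γ-prime , _) (Γ⊆□Δ , _) ⊢⊥ →
    □-elim-⊆□ Γ-prime Γ⊆□Δ □⊥∈Φ (⊥-elim ⊢⊥)

  ⊑-backwardConfluent : BackwardConfluent _≼_ _⊑_
  ⊑-backwardConfluent = ↾-backwardConfluent λ {(Γ , _)} (Γ-prime , _) (Γ⊆□Δ , _) Δ⊆Θ →
    (Γ , nothing) , (Γ-prime , Maybe.nothing) , id , Δ⊆Θ ∘ Γ⊆□Δ , drop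

  canonical : CS4Model
  canonical = record
    { model = record
      { frame = record
        { W            = World
        ; W⊥           = IsWorld ∩ Proves ⊥′
        ; _≼_          = _≼_
        ; _⊑_          = _⊑_
        ; ≼-isPreorder = ↾-isPreorder λ Γ⊆Δ Δ⊆Θ → Δ⊆Θ ∘ Γ⊆Δ
        ; ⊑-isPreorder = ↾-isPreorder ⊑₀-trans
        ; W⊥-≼-closed  = Proves-≼-closed ⊥′
        ; W⊥-⊑-closed  = Proves⊥-⊑-closed
        }
      ; V          = λ p → IsWorld ∩ Proves (var p)
      ; V-≼-closed = λ p → Proves-≼-closed (var p)
      ; W⊥⊆V       = λ p (wx , ⊢⊥) → wx , ⊥-elim ⊢⊥
      }
    ; isCS4Frame = ⊑-backwardConfluent
    }

  open CS4Model canonical using (model)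

  World-finite : Finite World
  World-finite = ×-finite (Subset-finite _) (Maybe-finite (Fin-finite _))

  ≼-elim : IsWorld x → x ≼ y → IsWorld y × x ≼₀ y
  ≼-elim = ↾-elim {R = _≼₀_} id

  ⊑-elim : IsWorld x → x ⊑ y → IsWorld y × x ⊑₀ y
  ⊑-elim = ↾-elim {R = _⊑₀_} (proj₁ , keep)

  Proves-∨⁻ : φ ∨ ψ ∈ Φ → IsWorld x → Proves (φ ∨ ψ) x → Proves φ x ⊎ Proves ψ x
  Proves-∨⁻ φ∨ψ∈Φ (Γ-prime , _) =
    Sum.map hyp hyp ∘ IsPrime.prime Γ-prime (Φ-closed ∨ˡ φ∨ψ∈Φ) (Φ-closed ∨ʳ φ∨ψ∈Φ)

  Proves-□⁻ : □ φ ∈ Φ → IsWorld x → Proves (□ φ) x → x ⊑₀ y → Proves φ y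
  Proves-□⁻ □φ∈Φ (Γ-prime , _) ⊢□φ (Γ⊆□Δ , _) = □-elim-⊆□ Γ-prime Γ⊆□Δ □φ∈Φ ⊢□φ

  full-isWorld : IsWorld (fullₛ , nothing)
  full-isWorld = full-prime , Maybe.nothing
    where
    full-prime : IsPrime (_∈ Φ) ⟦ fullₛ ⟧
    full-prime = record
      { closed = λ φ∈Φ _   → ⟦full⟧ φ∈Φ
      ; prime  = λ φ∈Φ _ _ → inj₁ (⟦full⟧ φ∈Φ)
      }

  full⊢ : ⟦ fullₛ ⟧ ⊢ φ
  full⊢ = ⊥-elim (hyp (⟦full⟧ (Φ-closed □⁻ □⊥∈Φ)))

  module TruthLemma (⊢?  : ∀ {φ} → φ ∈ Φ → Decides φ)
                    (⊢◇? : ∀ {φ} → φ ∈ Φ → Decides (◇ φ)) where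

    Proves-⇒⁺ : φ ∈ Φ → ψ ∈ Φ →
                (∀ {y} → IsWorld y → x ≼₀ y → Proves φ y → Proves ψ y) → Proves (φ ⇒ ψ) x
    Proves-⇒⁺ {x = Γ , _} φ∈Φ ψ∈Φ ⊢φ→⊢ψ
      with lindenbaum (⊢? ψ∈Φ) (∪-representable φ∈Φ (⟦⟧-representable Γ))
    ... | inj₁ φ⊢ψ = deduction φ⊢ψ
    ... | inj₂ (Δ , Γ∪φ⊆Δ , Δ-prime , Δ⊬ψ) = contradiction
      (⊢φ→⊢ψ {Δ , nothing} (Δ-prime , Maybe.nothing) (Γ∪φ⊆Δ ∘ inj₁) (hyp (Γ∪φ⊆Δ (inj₂ refl)))) Δ⊬ψ

    Proves-□⁺ : φ ∈ Φ → IsWorld x →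
                (∀ {y z} → IsWorld y → x ≼₀ y → IsWorld z → y ⊑₀ z → Proves φ z) → Proves (□ φ) x
    Proves-□⁺ {x = Γ , _} φ∈Φ (Γ-prime , _) ∀⊢φ
      with lindenbaum (⊢? φ∈Φ) (∩-representable boxed? (⟦⟧-representable Γ))
    ... | inj₁ ⊢φ = □-intro ⊢φ
    ... | inj₂ (Δ , Γ⊆□Δ , Δ-prime , Δ⊬φ) = contradiction
      (∀⊢φ {Γ , nothing} {Δ , nothing}
        (Γ-prime , Maybe.nothing) id (Δ-prime , Maybe.nothing) (Γ⊆□Δ , keep)) Δ⊬φ

    Proves-◇⁺ : φ ∈ Φ → IsWorld x →
                (∀ {y} → IsWorld y → x ≼₀ y → ∃[ z ] IsWorld z × y ⊑₀ z × Proves φ z) →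
                Proves (◇ φ) x
    Proves-◇⁺ {x = Γ , _} φ∈Φ (Γ-prime , _) ∃⊢φ with i , refl ← ∈⇒lookup φ∈Φ with ⊢◇? φ∈Φ Γ
    ... | yes ⊢◇φ = ⊢◇φ
    ... | no  ⊬◇φ with ∃⊢φ {Γ , just i} (Γ-prime , Maybe.just ⊬◇φ) id
    ...   | _ , (_ , Maybe.just Δ⊬◇φ) , (_ , keep) , Δ⊢φ = contradiction (mp (thm T◇) Δ⊢φ) Δ⊬◇φ

    Proves-◇⁻ : φ ∈ Φ → IsWorld x → Proves (◇ φ) x → ∃[ y ] IsWorld y × x ⊑₀ y × Proves φ y
    -- Without a promise, the fallible world full is reachable and proves everything.
    Proves-◇⁻ {x = _ , nothing} _ _ _ =
      (fullₛ , nothing) , full-isWorld , (⟦⟧-mono ⊆⊤ ∘ proj₁ , keep) , full⊢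
    Proves-◇⁻ {x = Γ , just i} φ∈Φ (_ , Maybe.just ⊬◇ψ) ⊢◇φ
      with lindenbaum (⊢◇? (∈-lookup i))
             (∪-representable φ∈Φ (∩-representable boxed? (⟦⟧-representable Γ)))
    ... | inj₁ ⊢◇ψ = contradiction (◇-elim ⊢◇ψ ⊢◇φ) ⊬◇ψ
    ... | inj₂ (Δ , Γ□∪φ⊆Δ , Δ-prime , Δ⊬◇ψ) =
      (Δ , just i) , (Δ-prime , Maybe.just Δ⊬◇ψ) , (Γ□∪φ⊆Δ ∘ inj₁ , keep) , hyp (Γ□∪φ⊆Δ (inj₂ refl))

    ⊢⇒⊨ : ∀ φ → φ ∈ Φ → IsWorld x → Proves φ x → ⟨ model , x ⟩⊨ φ
    ⊨⇒⊢ : ∀ φ → φ ∈ Φ → IsWorld x → ⟨ model , x ⟩⊨ φ → Proves φ x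

    ⊢⇒⊨ (var p) _ wx ⊢p = wx , ⊢p
    ⊢⇒⊨ ⊥′      _ wx ⊢⊥ = wx , ⊢⊥
    ⊢⇒⊨ (φ ∧ ψ) φ∧ψ∈Φ wx ⊢φ∧ψ =
      ⊢⇒⊨ φ (Φ-closed ∧ˡ φ∧ψ∈Φ) wx (mp (ax ∧-E₁) ⊢φ∧ψ) ,
      ⊢⇒⊨ ψ (Φ-closed ∧ʳ φ∧ψ∈Φ) wx (mp (ax ∧-E₂) ⊢φ∧ψ)
    ⊢⇒⊨ (φ ∨ ψ) φ∨ψ∈Φ wx ⊢φ∨ψ =
      Sum.map (⊢⇒⊨ φ (Φ-closed ∨ˡ φ∨ψ∈Φ) wx) (⊢⇒⊨ ψ (Φ-closed ∨ʳ φ∨ψ∈Φ) wx)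
              (Proves-∨⁻ φ∨ψ∈Φ wx ⊢φ∨ψ)
    ⊢⇒⊨ (φ ⇒ ψ) φ⇒ψ∈Φ wx ⊢φ⇒ψ _ x≼y ⊨φ =
      let wy , Γ⊆Δ = ≼-elim wx x≼y
          ⊢φ       = ⊨⇒⊢ φ (Φ-closed ⇒ˡ φ⇒ψ∈Φ) wy ⊨φ
      in  ⊢⇒⊨ ψ (Φ-closed ⇒ʳ φ⇒ψ∈Φ) wy (mp (weaken Γ⊆Δ ⊢φ⇒ψ) ⊢φ)
    ⊢⇒⊨ (◇ φ) ◇φ∈Φ wx ⊢◇φ _ x≼y =
      let φ∈Φ                = Φ-closed ◇⁻ ◇φ∈Φ
          wy , Γ⊆Δ           = ≼-elim wx x≼y
          z , wz , y⊑₀z , ⊢φ = Proves-◇⁻ φ∈Φ wy (weaken Γ⊆Δ ⊢◇φ)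
      in  z , [ wy , wz , y⊑₀z ] , ⊢⇒⊨ φ φ∈Φ wz ⊢φ
    ⊢⇒⊨ (□ φ) □φ∈Φ wx ⊢□φ _ _ x≼y y⊑z =
      let wy , Γ⊆Δ  = ≼-elim wx x≼y
          wz , y⊑₀z = ⊑-elim wy y⊑z
      in  ⊢⇒⊨ φ (Φ-closed □⁻ □φ∈Φ) wz (Proves-□⁻ □φ∈Φ wy (weaken Γ⊆Δ ⊢□φ) y⊑₀z)

    ⊨⇒⊢ (var p) _ _ (_ , ⊢p) = ⊢p
    ⊨⇒⊢ ⊥′      _ _ (_ , ⊢⊥) = ⊢⊥
    ⊨⇒⊢ (φ ∧ ψ) φ∧ψ∈Φ wx (⊨φ , ⊨ψ) =
      mp (mp (ax ∧-I) (⊨⇒⊢ φ (Φ-closed ∧ˡ φ∧ψ∈Φ) wx ⊨φ)) (⊨⇒⊢ ψ (Φ-closed ∧ʳ φ∧ψ∈Φ) wx ⊨ψ)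
    ⊨⇒⊢ (φ ∨ ψ) φ∨ψ∈Φ wx (inj₁ ⊨φ) = mp (ax ∨-I₁) (⊨⇒⊢ φ (Φ-closed ∨ˡ φ∨ψ∈Φ) wx ⊨φ)
    ⊨⇒⊢ (φ ∨ ψ) φ∨ψ∈Φ wx (inj₂ ⊨ψ) = mp (ax ∨-I₂) (⊨⇒⊢ ψ (Φ-closed ∨ʳ φ∨ψ∈Φ) wx ⊨ψ)
    ⊨⇒⊢ {x = x} (φ ⇒ ψ) φ⇒ψ∈Φ wx ⊨φ⇒ψ =
      let φ∈Φ = Φ-closed ⇒ˡ φ⇒ψ∈Φ
          ψ∈Φ = Φ-closed ⇒ʳ φ⇒ψ∈Φ
      in  Proves-⇒⁺ {x = x} φ∈Φ ψ∈Φ λ wy x≼₀y ⊢φ →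
            ⊨⇒⊢ ψ ψ∈Φ wy (⊨φ⇒ψ _ [ wx , wy , x≼₀y ] (⊢⇒⊨ φ φ∈Φ wy ⊢φ))
    ⊨⇒⊢ (◇ φ) ◇φ∈Φ wx ⊨◇φ =
      let φ∈Φ = Φ-closed ◇⁻ ◇φ∈Φ
      in  Proves-◇⁺ φ∈Φ wx λ wy x≼₀y →
            let z , y⊑z , ⊨φ = ⊨◇φ _ [ wx , wy , x≼₀y ]
                wz , y⊑₀z    = ⊑-elim wy y⊑z
            in  z , wz , y⊑₀z , ⊨⇒⊢ φ φ∈Φ wz ⊨φ
    ⊨⇒⊢ (□ φ) □φ∈Φ wx ⊨□φ =
      let φ∈Φ = Φ-closed □⁻ □φ∈Φ
      in  Proves-□⁺ φ∈Φ wx λ wy x≼₀y wz y⊑₀z →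
            ⊨⇒⊢ φ φ∈Φ wz (⊨□φ _ _ [ wx , wy , x≼₀y ] [ wy , wz , y⊑₀z ])

    ⊨⇒CS4⊢ : φ ∈ Φ → model ⊨ φ → CS4⊢ φ
    ⊨⇒CS4⊢ {φ} φ∈Φ ⊨φ with lindenbaum (⊢? φ∈Φ) ∅-representable
    ... | inj₁ ∅⊢φ = ∅⊢⇒CS4⊢ ∅⊢φ
    ... | inj₂ (Γ , _ , Γ-prime , Γ⊬φ) =
      contradiction (⊨⇒⊢ φ φ∈Φ isWorld (⊨φ (Γ , nothing) infallible)) Γ⊬φ
      where
      isWorld : IsWorld (Γ , nothing)
      isWorld = Γ-prime , Maybe.nothing

      infallible : ¬ (IsWorld ∩ Proves ⊥′) (Γ , nothing)
      infallible (_ , ⊢⊥) = Γ⊬φ (⊥-elim ⊢⊥)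

  canonical-complete : φ ∈ Φ → model ⊨ φ → ¬ ¬ (CS4⊢ φ)
  canonical-complete φ∈Φ ⊨φ ⊬φ = ¬¬-decides id λ ⊢? → ¬¬-decides ◇_ λ ⊢◇? →
    ⊬φ (TruthLemma.⊨⇒CS4⊢ ⊢? ⊢◇? φ∈Φ ⊨φ)

finite-countermodel : ∀ φ → ¬ (CS4⊢ φ) →
  Σ[ M ∈ CS4Model ] (Finite (CS4Model.W M) × ¬ (CS4Model.model M ⊨ φ))
finite-countermodel φ ⊬φ =
  canonical , World-finite , λ ⊨φ → canonical-complete (Φ-closed ∧ˡ (here refl)) ⊨φ ⊬φ
  where
  Φ-closed : SubformulaClosed (_∈ subformulas (φ ∧ □ ⊥′))
  Φ-closed = subformulas-closed (φ ∧ □ ⊥′)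

  open Canonical (subformulas (φ ∧ □ ⊥′)) Φ-closed (Φ-closed ∧ʳ (here refl))

mainTheorem1 : (∀ (φ : Formula) → ¬ (CS4⊢ φ) →
                  Σ[ M ∈ CS4Model ] (Finite (CS4Model.W M) × ¬ (CS4Model.model M ⊨ φ)))
               × (∀ (φ : Formula) → CS4⊢ φ → ∀ (M : CS4Model) → CS4Model.model M ⊨ φ)
mainTheorem1 = finite-countermodel , λ φ ⊢φ M w _ →
  let open CS4Model M in CS4-sound model isCS4Frame ⊢φ w
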